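{- The variety $\mathbf{V}(\mathrm{Rel}^i(\cdot,\circ,0,1))$ generated by the class of integral relation algebras of similarity type $(\cdot,\circ,0,1)$ is axiomatized by the set of equations $\mathrm{Ax}^i(\cdot,\circ,0,1)$. That is, an equation in the signature $(\cdot,\circ,0,1)$ is valid in every integral relation algebra of this signature if and only if it is derivable in equational logic from $\mathrm{Ax}^i(\cdot,\circ,0,1)$.
   Context: An algebra $\mathfrak{A}=(A,\cdot,\circ,0,1)$ is a relation algebra (of this signature) if there is a set $U$ with $A\subseteq\wp(U\times U)$, where $\cdot$ is intersection, $\circ$ is relational composition $a\circ b=\{(u,v): \exists w\,((u,w)\in a,(w,v)\in b)\}$, $1$ is the identity relation on $U$ and $0$ is the empty relation. Such an algebra is integral if $1$ is an atom, i.e. a minimal nonzero element of $A$. $\mathrm{Rel}^i(\cdot,\circ,0,1)$ is the class of integral relation algebras of this signature, and $\mathbf{V}(K)$ denotes the variety generated by a class $K$. Conventions: $x\le y$ abbreviates $x\cdot y=x$; $\circ$ binds tighter than $\cdot$. $\mathrm{Ax}(\cdot,\circ,0,1)$ consists of: the semilattice axioms for $\cdot$; the monoid axioms for $\circ$ and $1$; monotonicity $(x\cdot x')\circ(y\cdot y')\le x\circ y$; $0=0\cdot x$; $0=0\circ x=x\circ 0$; $(1\cdot x)\circ(1\cdot y)=1\cdot x\cdot y$; $(1\cdot x)\circ(y\cdot z)=((1\cdot x)\circ y)\cdot z$; $(x\cdot y)\circ(1\cdot z)=x\cdot (y\circ(1\cdot z))$. $\mathrm{Ax}^i(\cdot,\circ,0,1)$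 is $\mathrm{Ax}(\cdot,\circ,0,1)$ together with the two equations $1\cdot(x\circ y)=1\cdot(y\circ x)$ and $(1\cdot x)\circ y=y\circ(1\cdot x)$. -}

module Defs where


open import Data.Nat using (ℕ)
open import Data.Empty using (⊥)
open import Data.Product using (Σ; _×_)
open import Data.Sum using (_⊎_)
open import Relation.Nullary using (¬_)
open import Relation.Binary.PropositionalEquality using (_≡_)

infixl 6 _·_
infixl 7 _∘_

data Term : Set where
  var : ℕ → Term
  _·_ : Term → Term → Term
  _∘_ : Term → Term → Term
  𝟎   : Term
  𝟏   : Term

_[_] : Term → (ℕ → Term) → Term
var i   [ σ ] = σ i
(s · t) [ σ ] = (s [ σ ]) · (t [ σ ])
(s ∘ t) [ σ ] = (s [ σ ]) ∘ (t [ σ ])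
𝟎       [ σ ] = 𝟎
𝟏       [ σ ] = 𝟏

-- The equations Ax^i(·,∘,0,1).  Variables: x = var 0, y = var 1,
-- z = var 2, x' = var 3, y' = var 4.  "s ≤ t" abbreviates s · t = s.

private
  x y z x' y' : Term
  x = var 0
  y = var 1
  z = var 2
  x' = var 3
  y' = var 4

data AxI : Term → Term → Set where
  idem   : AxI (x · x) x
  comm   : AxI (x · y) (y · x)
  assoc· : AxI ((x · y) · z) (x · (y · z))
  assoc∘ : AxI ((x ∘ y) ∘ z) (x ∘ (y ∘ z))
  unitl  : AxI (𝟏 ∘ x) x
  unitr  : AxI (x ∘ 𝟏) x
  -- monotonicity: (x·x')∘(y·y') ≤ x∘y
  mono   : AxI (((x · x') ∘ (y · y')) · (x ∘ y)) ((x · x') ∘ (y · y'))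
  zero·  : AxI 𝟎 (𝟎 · x)
  zero∘l : AxI 𝟎 (𝟎 ∘ x)
  zero∘r : AxI 𝟎 (x ∘ 𝟎)
  ax1    : AxI ((𝟏 · x) ∘ (𝟏 · y)) (𝟏 · x · y)
  ax2    : AxI ((𝟏 · x) ∘ (y · z)) (((𝟏 · x) ∘ y) · z)
  ax3    : AxI ((x · y) ∘ (𝟏 · z)) (x · (y ∘ (𝟏 · z)))
  int1   : AxI (𝟏 · (x ∘ y)) (𝟏 · (y ∘ x))
  int2   : AxI ((𝟏 · x) ∘ y) (y ∘ (𝟏 · x))

infix 4 Ax⊢_≈_
data Ax⊢_≈_ : Term → Term → Set where
  ax     : ∀ {s t} → AxI s t → Ax⊢ s ≈ t
  ≈refl  : ∀ {s} → Ax⊢ s ≈ s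
  ≈sym   : ∀ {s t} → Ax⊢ s ≈ t → Ax⊢ t ≈ s
  ≈trans : ∀ {s t u} → Ax⊢ s ≈ t → Ax⊢ t ≈ u → Ax⊢ s ≈ u
  ≈subst : ∀ {s t} (σ : ℕ → Term) → Ax⊢ s ≈ t → Ax⊢ (s [ σ ]) ≈ (t [ σ ])
  cong·  : ∀ {s s' t t'} → Ax⊢ s ≈ s' → Ax⊢ t ≈ t' → Ax⊢ s · t ≈ s' · t'
  cong∘  : ∀ {s s' t t'} → Ax⊢ s ≈ s' → Ax⊢ t ≈ t' → Ax⊢ s ∘ t ≈ s' ∘ t'

BRel : Set → Set₁
BRel U = U → U → Set

module _ {U : Set} where

  _∩_ : BRel U → BRel U → BRel U
  (a ∩ b) u v = a u v × b u v

  _⨾_ : BRel U → BRel U → BRel U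
  (a ⨾ b) u v = Σ U (λ w → a u w × b w v)

  ∅ : BRel U
  ∅ _ _ = ⊥

  Id : BRel U
  Id u v = u ≡ v

  _⊆_ : BRel U → BRel U → Set
  a ⊆ b = ∀ u v → a u v → b u v

  _≐_ : BRel U → BRel U → Set
  a ≐ b = (a ⊆ b) × (b ⊆ a)

⟦_⟧ : {U : Set} → Term → (ℕ → BRel U) → BRel U
⟦ var i ⟧ ρ = ρ i
⟦ s · t ⟧ ρ = ⟦ s ⟧ ρ ∩ ⟦ t ⟧ ρ
⟦ s ∘ t ⟧ ρ = ⟦ s ⟧ ρ ⨾ ⟦ t ⟧ ρ
⟦ 𝟎 ⟧ ρ = ∅
⟦ 𝟏 ⟧ ρ = Id

-- A ⊆ ℘(U×U) (a set of relations, closed under ≐) is the universe of a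
-- relation algebra of signature (·,∘,0,1) over the base U, and it is
-- integral: 1 is a minimal nonzero element of A.
record IsIntegralRelAlg (U : Set) (A : BRel U → Set₁) : Set₁ where
  field
    respects : ∀ {a b} → a ≐ b → A a → A b
    closed∩  : ∀ {a b} → A a → A b → A (a ∩ b)
    closed⨾  : ∀ {a b} → A a → A b → A (a ⨾ b)
    has∅     : A ∅
    hasId    : A Id
    Id≢∅     : ¬ (Id {U} ≐ ∅)
    Id-minimal : ∀ {a} → A a → a ⊆ Id → ¬ (a ≐ ∅) → a ≐ Id

ValidRelI : Term → Term → Set₂
ValidRelI s t = (U : Set) (A : BRel U → Set₁) → IsIntegralRelAlg U A →
  (ρ : ℕ → BRel U) → (∀ i → A (ρ i)) → ⟦ s ⟧ ρ ≐ ⟦ t ⟧ ρ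

{-# OPTIONS --safe #-}

-- Completeness.  Let G be a group and interpret every variable i by
-- {(u , u h) : h ∈ Hᵢ} with Hᵢ ⊆ G finite.  The relations of this form are an
-- integral relation algebra, constructively so if equality in G is decidable.
-- For a term s not provably 𝟎, let e ≤ 𝟏 be the composition of the loops that
-- occur in s; then s = s ∘ e.  It suffices to have such a model with an arrow g that
-- satisfies exactly the terms above s.  To control what it satisfies, label
-- the elements of G by filters Φ of terms such that Φ(g) ∘ Φ(h) ⊆ Φ(gh) and
-- Φ(1) = {t : e ≤ t}: then an arrow h satisfies only terms in Φ(h).  To make g
-- satisfy s, adjoin for each proper composition b ∘ c ∈ Φ(g) a free generator γ,
-- with b labelling γ and c labelling γ⁻¹g; reduced words then inherit labels, and
-- the cancellations γγ⁻¹ and γ⁻¹γ respect them because e is central and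
-- e ≤ a ∘ b implies e ≤ b ∘ a.

module Submission where

open import Defs
import Algebra.Properties.Group as GroupProperties
open import Algebra.Structures using (IsGroup)
open import Axiom.UniquenessOfIdentityProofs.WithK using (uip)
open import Data.Bool using (Bool; true; false; not; _∧_; _∨_; _xor_; if_then_else_)
import Data.Bool.Properties as Bool
open import Data.Bool.Properties using (not-¬)
open import Data.Empty using (⊥)
open import Data.List using (List; []; _∷_; filter; map; cartesianProductWith)
import Data.List.Membership.DecPropositional as DecMembership
open import Data.List.Membership.Propositional using (_∈_)
open import Data.List.Membership.Propositional.Properties using (∈-map⁺; ∈-map⁻; ∈-filter⁺; ∈-filter⁻; ∈-cartesianProductWith⁺; ∈-cartesianProductWith⁻)
open import Data.List.Relation.Unary.Any using (here; there)
import Data.Nat as ℕ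
open import Data.Nat using (ℕ)
open import Data.Product using (∃-syntax; Σ-syntax; _×_; _,_; proj₁; proj₂; swap)
open import Data.Sum using (_⊎_; inj₁; inj₂)
open import Data.Unit using (⊤; tt)
open import Level using (Lift; lift; 0ℓ)
open import Relation.Binary.Bundles using (Poset)
open import Relation.Binary.Definitions using (DecidableEquality)
open import Relation.Binary.PropositionalEquality using (_≡_; refl; sym; trans; cong; cong₂; subst; isEquivalence; module ≡-Reasoning)
import Relation.Binary.Reasoning.PartialOrder as PosetReasoning
open import Relation.Nullary using (Dec; yes; no; does; ¬_; contradiction)
open import Relation.Nullary.Decidable using (dec-true)

-- The order on terms and consequences of the axioms.

infix 4 _≤_

_≤_ : Term → Term → Set
a ≤ b = Ax⊢ a · b ≈ a

private variable
  a a' b b' c e e' p q s t : Term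

axiom : ∀ {l r} → AxI l r → (x y z x' y' : Term) →
        let σ = λ { 0 → x ; 1 → y ; 2 → z ; 3 → x' ; _ → y' } in Ax⊢ l [ σ ] ≈ r [ σ ]
axiom l≈r x y z x' y' = ≈subst _ (ax l≈r)

·-idem : ∀ a → Ax⊢ a · a ≈ a
·-idem a = axiom idem a a a a a

·-comm : ∀ a b → Ax⊢ a · b ≈ b · a
·-comm a b = axiom comm a b a a a

·-assoc : ∀ a b c → Ax⊢ (a · b) · c ≈ a · (b · c)
·-assoc a b c = axiom assoc· a b c a a

∘-assoc : ∀ a b c → Ax⊢ (a ∘ b) ∘ c ≈ a ∘ (b ∘ c)
∘-assoc a b c = axiom assoc∘ a b c a a

∘-identityˡ : ∀ a → Ax⊢ 𝟏 ∘ a ≈ a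
∘-identityˡ a = axiom unitl a a a a a

∘-identityʳ : ∀ a → Ax⊢ a ∘ 𝟏 ≈ a
∘-identityʳ a = axiom unitr a a a a a

≤-reflexive : Ax⊢ a ≈ b → a ≤ b
≤-reflexive {a} a≈b = ≈trans (cong· ≈refl (≈sym a≈b)) (·-idem a)

≤-refl : a ≤ a
≤-refl = ≤-reflexive ≈refl

≤-trans : a ≤ b → b ≤ c → a ≤ c
≤-trans {a} {b} {c} a≤b b≤c =
  ≈trans (cong· (≈sym a≤b) ≈refl) (≈trans (·-assoc a b c) (≈trans (cong· ≈refl b≤c) a≤b))

≤-antisym : a ≤ b → b ≤ a → Ax⊢ a ≈ b
≤-antisym {a} {b} a≤b b≤a = ≈trans (≈sym a≤b) (≈trans (·-comm a b) b≤a)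

poset : Poset 0ℓ 0ℓ 0ℓ
poset = record
  { Carrier = Term
  ; _≈_ = Ax⊢_≈_
  ; _≤_ = _≤_
  ; isPartialOrder = record
    { isPreorder = record
      { isEquivalence = record { refl = ≈refl ; sym = ≈sym ; trans = ≈trans }
      ; reflexive = ≤-reflexive
      ; trans = ≤-trans
      }
    ; antisym = ≤-antisym
    }
  }

module ≤-Reasoning = PosetReasoning poset

·-lowerˡ : a · b ≤ a
·-lowerˡ {a} {b} = ≈trans (·-comm _ a) (≈trans (≈sym (·-assoc a a b)) (cong· (·-idem a) ≈refl))

·-lowerʳ : a · b ≤ b
·-lowerʳ {a} {b} = ≈trans (·-assoc a b b) (cong· ≈refl (·-idem b))

·-greatest : a ≤ b → a ≤ c → a ≤ b · c
·-greatest {a} {b} {c} a≤b a≤c = ≈trans (≈sym (·-assoc a b c)) (≈trans (cong· a≤b ≈refl) a≤c)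

·-mono : a ≤ a' → b ≤ b' → a · b ≤ a' · b'
·-mono a≤a' b≤b' = ·-greatest (≤-trans ·-lowerˡ a≤a') (≤-trans ·-lowerʳ b≤b')

∘-mono : a ≤ a' → b ≤ b' → a ∘ b ≤ a' ∘ b'
∘-mono {a} {a'} {b} {b'} a≤a' b≤b' = begin
  a ∘ b                ≈⟨ cong∘ (a≈ a≤a') (a≈ b≤b') ⟩
  (a' · a) ∘ (b' · b)  ≤⟨ axiom mono a' b' a a b ⟩
  a' ∘ b'              ∎
  where
  open ≤-Reasoning
  a≈ : ∀ {u v} → u ≤ v → Ax⊢ u ≈ v · u
  a≈ {u} {v} u≤v = ≈trans (≈sym u≤v) (·-comm u v)

∘-monoˡ : a ≤ a' → a ∘ b ≤ a' ∘ b
∘-monoˡ a≤a' = ∘-mono a≤a' ≤-refl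

∘-monoʳ : b ≤ b' → a ∘ b ≤ a ∘ b'
∘-monoʳ = ∘-mono ≤-refl

∘-contractˡ : a ≤ 𝟏 → a ∘ b ≤ b
∘-contractˡ a≤𝟏 = ≤-trans (∘-monoˡ a≤𝟏) (≤-reflexive (∘-identityˡ _))

∘-contractʳ : b ≤ 𝟏 → a ∘ b ≤ a
∘-contractʳ b≤𝟏 = ≤-trans (∘-monoʳ b≤𝟏) (≤-reflexive (∘-identityʳ _))

𝟎-least : 𝟎 ≤ a
𝟎-least {a} = ≈sym (axiom zero· a a a a a)

∘-zeroˡ : a ≤ 𝟎 → a ∘ b ≤ 𝟎
∘-zeroˡ {a} {b} a≤𝟎 = ≤-trans (∘-monoˡ a≤𝟎) (≤-reflexive (≈sym (axiom zero∘l b b b b b)))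

∘-zeroʳ : b ≤ 𝟎 → a ∘ b ≤ 𝟎
∘-zeroʳ {b} {a} b≤𝟎 = ≤-trans (∘-monoʳ b≤𝟎) (≤-reflexive (≈sym (axiom zero∘r a a a a a)))

-- The axioms address subidentities in the form `𝟏 · x`; this puts every `e ≤ 𝟏` into that form, so
-- that `int2`, `ax1` and `ax3` apply to it.
subidentity-≈ : e ≤ 𝟏 → Ax⊢ e ≈ 𝟏 · e
subidentity-≈ {e} e≤𝟏 = ≈trans (≈sym e≤𝟏) (·-comm e 𝟏)

subidentity-central : e ≤ 𝟏 → ∀ a → Ax⊢ e ∘ a ≈ a ∘ e
subidentity-central {e} e≤𝟏 a =
  ≈trans (cong∘ e≈ ≈refl) (≈trans (axiom int2 e a a a a) (cong∘ ≈refl (≈sym e≈)))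
  where e≈ = subidentity-≈ e≤𝟏

subidentity-idem : e ≤ 𝟏 → Ax⊢ e ∘ e ≈ e
subidentity-idem {e} e≤𝟏 =
  ≈trans (cong∘ e≈ e≈) (≈trans (axiom ax1 e e e e e) (≈trans (cong· (≈sym e≈) ≈refl) (·-idem e)))
  where e≈ = subidentity-≈ e≤𝟏

subidentity-·-∘ : e ≤ 𝟏 → ∀ a b → Ax⊢ a · (b ∘ e) ≈ (a · b) ∘ e
subidentity-·-∘ {e} e≤𝟏 a b =
  ≈trans (cong· ≈refl (cong∘ ≈refl e≈)) (≈trans (≈sym (axiom ax3 a b e a a)) (cong∘ ≈refl (≈sym e≈)))
  where e≈ = subidentity-≈ e≤𝟏

rotate : e ≤ 𝟏 → e ≤ a ∘ b → e ≤ b ∘ a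
rotate {e} {a} {b} e≤𝟏 e≤ab = begin
  e            ≤⟨ ·-greatest e≤𝟏 e≤ab ⟩
  𝟏 · (a ∘ b)  ≈⟨ axiom int1 a b a a a ⟩
  𝟏 · (b ∘ a)  ≤⟨ ·-lowerʳ ⟩
  b ∘ a        ∎
  where open ≤-Reasoning

-- Loops inside a term and its test part.

test : Term → Bool
test (var _) = false
test (s · t) = test s ∨ test t
test (s ∘ t) = test s ∧ test t
test 𝟎       = true
test 𝟏       = true

∨-true : ∀ x y → x ∨ y ≡ true → x ≡ true ⊎ y ≡ true
∨-true true  y eq = inj₁ refl
∨-true false y eq = inj₂ eq

∧-true : ∀ x y → x ∧ y ≡ true → x ≡ true × y ≡ true
∧-true true y eq = refl , eq

test⇒≤𝟏 : ∀ t → test t ≡ true → t ≤ 𝟏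
test⇒≤𝟏 (s · t) eq with ∨-true (test s) (test t) eq
... | inj₁ s-test = ≤-trans ·-lowerˡ (test⇒≤𝟏 s s-test)
... | inj₂ t-test = ≤-trans ·-lowerʳ (test⇒≤𝟏 t t-test)
test⇒≤𝟏 (s ∘ t) eq with ∧-true (test s) (test t) eq
... | s-test , t-test = ≤-trans (∘-contractˡ (test⇒≤𝟏 s s-test)) (test⇒≤𝟏 t t-test)
test⇒≤𝟏 𝟎 _ = 𝟎-least
test⇒≤𝟏 𝟏 _ = ≤-refl

-- No 𝟎 occurs, and every meet that collapses to a loop is implied by e.
Good : Term → Term → Set
Good e (var _) = ⊤
Good e (s · t) = Good e s × Good e t × (test (s · t) ≡ true → e ≤ s · t)
Good e (s ∘ t) = Good e s × Good e t
Good e 𝟎       = ⊥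
Good e 𝟏       = ⊤

Good-antitone : ∀ t → e ≤ e' → Good e' t → Good e t
Good-antitone (var _) _    _ = tt
Good-antitone (s · t) e≤e' (s-good , t-good , e'≤) =
  Good-antitone s e≤e' s-good , Good-antitone t e≤e' t-good , λ eq → ≤-trans e≤e' (e'≤ eq)
Good-antitone (s ∘ t) e≤e' (s-good , t-good) =
  Good-antitone s e≤e' s-good , Good-antitone t e≤e' t-good
Good-antitone 𝟏       _    _ = tt

-- Meets are bounded by `Good` itself, compositions by idempotence of `e`. Hence tests may be
-- realized at the unit, whose labels are the terms above `e`.
test-Good : ∀ t → e ≤ 𝟏 → Good e t → test t ≡ true → e ≤ t
test-Good (s · t) _   (_ , _ , e≤)       eq = e≤ eq
test-Good (s ∘ t) e≤𝟏 (s-good , t-good) eq with ∧-true (test s) (test t) eq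
... | s-test , t-test =
  ≤-trans (≤-reflexive (≈sym (subidentity-idem e≤𝟏)))
          (∘-mono (test-Good s e≤𝟏 s-good s-test) (test-Good t e≤𝟏 t-good t-test))
test-Good 𝟏       e≤𝟏 _                  _  = e≤𝟏

record TestPart (s : Term) : Set where
  constructor testPart
  field
    part   : Term
    part≤𝟏 : part ≤ 𝟏
    absorb : s ≤ s ∘ part
    good   : Good part s

𝟏-part : ∀ s → Good 𝟏 s → TestPart s
𝟏-part s = testPart 𝟏 ≤-refl (≤-reflexive (≈sym (∘-identityʳ s)))

-- `ax3` moves a subidentity out of the right factor of a meet; commuting the meet moves out the
-- other one.
·-absorb : e ≤ 𝟏 → e' ≤ 𝟏 → s ≤ s ∘ e → t ≤ t ∘ e' → s · t ≤ (s · t) ∘ (e ∘ e')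
·-absorb {e} {e'} {s} {t} e≤𝟏 e'≤𝟏 s≤ t≤ = begin
  s · t                ≤⟨ ·-mono s≤ t≤ ⟩
  (s ∘ e) · (t ∘ e')   ≈⟨ subidentity-·-∘ e'≤𝟏 (s ∘ e) t ⟩
  ((s ∘ e) · t) ∘ e'   ≈⟨ cong∘ (·-comm (s ∘ e) t) ≈refl ⟩
  (t · (s ∘ e)) ∘ e'   ≈⟨ cong∘ (subidentity-·-∘ e≤𝟏 t s) ≈refl ⟩
  ((t · s) ∘ e) ∘ e'   ≈⟨ cong∘ (cong∘ (·-comm t s) ≈refl) ≈refl ⟩
  ((s · t) ∘ e) ∘ e'   ≈⟨ ∘-assoc (s · t) e e' ⟩
  (s · t) ∘ (e ∘ e')   ∎
  where open ≤-Reasoning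

∘-absorb : e ≤ 𝟏 → s ≤ s ∘ e → t ≤ t ∘ e' → s ∘ t ≤ (s ∘ t) ∘ (e ∘ e')
∘-absorb {e} {s} {t} {e'} e≤𝟏 s≤ t≤ = begin
  s ∘ t                ≤⟨ ∘-mono s≤ t≤ ⟩
  (s ∘ e) ∘ (t ∘ e')   ≈⟨ ∘-assoc s e (t ∘ e') ⟩
  s ∘ (e ∘ (t ∘ e'))   ≈⟨ cong∘ ≈refl (∘-assoc e t e') ⟨
  s ∘ ((e ∘ t) ∘ e')   ≈⟨ cong∘ ≈refl (cong∘ (subidentity-central e≤𝟏 t) ≈refl) ⟩
  s ∘ ((t ∘ e) ∘ e')   ≈⟨ cong∘ ≈refl (∘-assoc t e e') ⟩
  s ∘ (t ∘ (e ∘ e'))   ≈⟨ ∘-assoc s t (e ∘ e') ⟨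
  (s ∘ t) ∘ (e ∘ e')   ∎
  where open ≤-Reasoning

test-absorb : s ≤ 𝟏 → s ≤ s ∘ e → s ≤ s ∘ (e ∘ s)
test-absorb {s} {e} s≤𝟏 s≤ = begin
  s            ≈⟨ subidentity-idem s≤𝟏 ⟨
  s ∘ s        ≤⟨ ∘-monoˡ s≤ ⟩
  (s ∘ e) ∘ s  ≈⟨ ∘-assoc s e s ⟩
  s ∘ (e ∘ s)  ∎
  where open ≤-Reasoning

-- A factor below `𝟎` annihilates the term. Otherwise the parts of both factors are composed; the
-- result lies below each, so `Good` is inherited.
zero-or-testPart : ∀ s → s ≤ 𝟎 ⊎ TestPart s
zero-or-testPart (var i) = inj₂ (𝟏-part (var i) tt)
zero-or-testPart 𝟎       = inj₁ ≤-refl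
zero-or-testPart 𝟏       = inj₂ (𝟏-part 𝟏 tt)
zero-or-testPart (s ∘ t) with zero-or-testPart s | zero-or-testPart t
... | inj₁ s≤𝟎 | _        = inj₁ (∘-zeroˡ s≤𝟎)
... | inj₂ _   | inj₁ t≤𝟎 = inj₁ (∘-zeroʳ t≤𝟎)
... | inj₂ (testPart e e≤𝟏 s≤ s-good) | inj₂ (testPart e' e'≤𝟏 t≤ t-good) = inj₂ record
  { part   = e ∘ e'
  ; part≤𝟏 = ≤-trans (∘-contractˡ e≤𝟏) e'≤𝟏
  ; absorb = ∘-absorb e≤𝟏 s≤ t≤
  ; good   = Good-antitone s (∘-contractʳ e'≤𝟏) s-good , Good-antitone t (∘-contractˡ e≤𝟏) t-good
  }
zero-or-testPart (s · t) with zero-or-testPart s | zero-or-testPart t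
... | inj₁ s≤𝟎 | _        = inj₁ (≤-trans ·-lowerˡ s≤𝟎)
... | inj₂ _   | inj₁ t≤𝟎 = inj₁ (≤-trans ·-lowerʳ t≤𝟎)
... | inj₂ (testPart e e≤𝟏 s≤ s-good) | inj₂ (testPart e' e'≤𝟏 t≤ t-good)
  with test (s · t) in eq
... | false = inj₂ record
  { part   = e ∘ e'
  ; part≤𝟏 = ≤-trans (∘-contractˡ e≤𝟏) e'≤𝟏
  ; absorb = ·-absorb e≤𝟏 e'≤𝟏 s≤ t≤
  ; good   = Good-antitone s (∘-contractʳ e'≤𝟏) s-good , Good-antitone t (∘-contractˡ e≤𝟏) t-good
           , λ eq' → contradiction eq' (not-¬ eq)
  }
-- The meet is itself a loop, so it joins the part: this yields the bound that `Good` demands for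
-- it, and idempotence of `s · t` keeps absorption.
... | true  = inj₂ record
  { part   = (e ∘ e') ∘ (s · t)
  ; part≤𝟏 = ≤-trans (∘-contractˡ ee'≤𝟏) st≤𝟏
  ; absorb = test-absorb st≤𝟏 (·-absorb e≤𝟏 e'≤𝟏 s≤ t≤)
  ; good   = Good-antitone s (≤-trans (∘-contractʳ st≤𝟏) (∘-contractʳ e'≤𝟏)) s-good
           , Good-antitone t (≤-trans (∘-contractʳ st≤𝟏) (∘-contractˡ e≤𝟏)) t-good
           , λ _ → ∘-contractˡ ee'≤𝟏
  }
  where
  st≤𝟏 : s · t ≤ 𝟏
  st≤𝟏 = test⇒≤𝟏 (s · t) eq
  ee'≤𝟏 : e ∘ e' ≤ 𝟏
  ee'≤𝟏 = ≤-trans (∘-contractˡ e≤𝟏) e'≤𝟏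

-- The free product of a group with an infinite cyclic group, by reduced words.

module FreeExtension {G : Set} {_∙_ : G → G → G} {ε : G} {_⁻¹ : G → G}
                     (isGroup : IsGroup _≡_ _∙_ ε _⁻¹) (_≟_ : DecidableEquality G) where

  open IsGroup isGroup using (assoc; identityˡ; identityʳ; inverseˡ; inverseʳ)

  infixr 6 _⟨_⟩_
  infixr 6 _⊙_
  infixl 7 _⊛_

  -- g ⟨ δ ⟩ w stands for g γ w if δ = true and for g γ⁻¹ w if δ = false,
  -- where γ is the adjoined free generator.
  data Word : Set where
    ⌈_⌉   : G → Word
    _⟨_⟩_ : G → Bool → Word → Word

  cancels : Bool → Word → Bool
  cancels δ ⌈ _ ⌉         = false
  cancels δ (g ⟨ δ' ⟩ _) = does (g ≟ ε) ∧ (δ xor δ')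

  reduced : Word → Bool
  reduced ⌈ _ ⌉       = true
  reduced (_ ⟨ δ ⟩ w) = not (cancels δ w) ∧ reduced w

  tail : Word → Word
  tail ⌈ g ⌉       = ⌈ g ⌉
  tail (_ ⟨ _ ⟩ w) = w

  _⊙_ : G → Word → Word
  g ⊙ ⌈ h ⌉       = ⌈ g ∙ h ⌉
  g ⊙ (h ⟨ δ ⟩ w) = (g ∙ h) ⟨ δ ⟩ w

  push : Bool → Word → Word
  push δ w = if cancels δ w then tail w else ε ⟨ δ ⟩ w

  -- The letters of the left factor act in turn on the right factor, so only the latter must be
  -- reduced for the product to be reduced.
  _⊛_ : Word → Word → Word
  ⌈ g ⌉       ⊛ v = g ⊙ v
  (g ⟨ δ ⟩ w) ⊛ v = g ⊙ push δ (w ⊛ v)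

  inv : Word → Word
  inv ⌈ g ⌉       = ⌈ g ⁻¹ ⌉
  inv (g ⟨ δ ⟩ w) = inv w ⊛ (ε ⟨ not δ ⟩ ⌈ g ⁻¹ ⌉)

  ⊙-assoc : ∀ g h w → (g ∙ h) ⊙ w ≡ g ⊙ (h ⊙ w)
  ⊙-assoc g h ⌈ k ⌉       = cong ⌈_⌉ (assoc g h k)
  ⊙-assoc g h (k ⟨ δ ⟩ w) = cong (_⟨ δ ⟩ w) (assoc g h k)

  ⊙-identity : ∀ w → ε ⊙ w ≡ w
  ⊙-identity ⌈ k ⌉       = cong ⌈_⌉ (identityˡ k)
  ⊙-identity (k ⟨ δ ⟩ w) = cong (_⟨ δ ⟩ w) (identityˡ k)

  reduced-⊙ : ∀ g w → reduced w ≡ true → reduced (g ⊙ w) ≡ true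
  reduced-⊙ g ⌈ _ ⌉       eq = eq
  reduced-⊙ g (_ ⟨ _ ⟩ _) eq = eq

  reduced-tail : ∀ w → reduced w ≡ true → reduced (tail w) ≡ true
  reduced-tail ⌈ _ ⌉       eq = eq
  reduced-tail (_ ⟨ δ ⟩ w) eq = proj₂ (∧-true (not (cancels δ w)) (reduced w) eq)

  reduced-push : ∀ δ w → reduced w ≡ true → reduced (push δ w) ≡ true
  reduced-push δ w eq with cancels δ w in c
  ... | true  = reduced-tail w eq
  ... | false rewrite c = eq

  reduced-⊛ : ∀ u v → reduced v ≡ true → reduced (u ⊛ v) ≡ true
  reduced-⊛ ⌈ g ⌉       v eq = reduced-⊙ g v eq
  reduced-⊛ (g ⟨ δ ⟩ w) v eq = reduced-⊙ g (push δ (w ⊛ v)) (reduced-push δ (w ⊛ v) (reduced-⊛ w v eq))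

  cancels-not : ∀ δ w → cancels (not δ) (ε ⟨ δ ⟩ w) ≡ true
  cancels-not δ w rewrite dec-true (ε ≟ ε) refl with δ
  ... | true  = refl
  ... | false = refl

  cancels⇒ : ∀ δ w → cancels δ w ≡ true → w ≡ ε ⟨ not δ ⟩ tail w
  cancels⇒ δ (g ⟨ δ' ⟩ w) c with g ≟ ε
  cancels⇒ true  (g ⟨ false ⟩ w) _ | yes refl = refl
  cancels⇒ false (g ⟨ true ⟩ w)  _ | yes refl = refl

  push-reduced : ∀ g δ w → reduced (g ⟨ δ ⟩ w) ≡ true → push δ w ≡ ε ⟨ δ ⟩ w
  push-reduced g δ w eq with cancels δ w
  ... | false = refl

  push-cancelˡ : ∀ δ w → push (not δ) (ε ⟨ δ ⟩ w) ≡ w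
  push-cancelˡ δ w rewrite cancels-not δ w = refl

  push-cancelʳ : ∀ δ w → push δ (ε ⟨ not δ ⟩ w) ≡ w
  push-cancelʳ δ w =
    subst (λ δ' → push δ' (ε ⟨ not δ ⟩ w) ≡ w) (Bool.not-involutive δ) (push-cancelˡ (not δ) w)

  -- Van der Waerden's trick: on reduced words the two pushes are mutually inverse. After a
  -- cancellation the exposed tail cannot cancel again, so the second push restores the removed
  -- letter.
  push-push : ∀ δ w → reduced w ≡ true → push δ (push (not δ) w) ≡ w
  push-push δ w eq with cancels (not δ) w in c
  ... | true  = begin
    push δ (tail w)   ≡⟨ push-reduced ε δ (tail w) (subst (λ v → reduced v ≡ true) w≡ eq) ⟩
    ε ⟨ δ ⟩ tail w    ≡⟨ w≡ ⟨
    w                 ∎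
    where
    open ≡-Reasoning
    w≡ : w ≡ ε ⟨ δ ⟩ tail w
    w≡ = subst (λ δ' → w ≡ ε ⟨ δ' ⟩ tail w) (Bool.not-involutive δ) (cancels⇒ (not δ) w c)
  ... | false = push-cancelʳ δ w

  ⊙-⊛ : ∀ g u v → (g ⊙ u) ⊛ v ≡ g ⊙ (u ⊛ v)
  ⊙-⊛ g ⌈ h ⌉       v = ⊙-assoc g h v
  ⊙-⊛ g (h ⟨ δ ⟩ w) v = ⊙-assoc g h _

  -- Associativity for a single letter. If it cancels against `u`, then `u` begins with the opposite
  -- letter, and `push-push` removes the pair on the other side.
  push-⊛ : ∀ δ u v → reduced v ≡ true → push δ u ⊛ v ≡ push δ (u ⊛ v)
  push-⊛ δ u v eq with cancels δ u in c
  ... | false = ⊙-identity _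
  ... | true  = begin
    tail u ⊛ v                                    ≡⟨ push-push δ _ (reduced-⊛ (tail u) v eq) ⟨
    push δ (push (not δ) (tail u ⊛ v))            ≡⟨ cong (push δ) (⊙-identity (push (not δ) (tail u ⊛ v))) ⟨
    push δ ((ε ⟨ not δ ⟩ tail u) ⊛ v)             ≡⟨ cong (λ w → push δ (w ⊛ v)) (cancels⇒ δ u c) ⟨
    push δ (u ⊛ v)                                ∎
    where open ≡-Reasoning

  ⊛-assoc : ∀ u v w → reduced w ≡ true → (u ⊛ v) ⊛ w ≡ u ⊛ (v ⊛ w)
  ⊛-assoc ⌈ g ⌉        v w eq = ⊙-⊛ g v w
  ⊛-assoc (g ⟨ δ ⟩ u) v w eq = begin
    (g ⊙ push δ (u ⊛ v)) ⊛ w   ≡⟨ ⊙-⊛ g (push δ (u ⊛ v)) w ⟩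
    g ⊙ (push δ (u ⊛ v) ⊛ w)   ≡⟨ cong (g ⊙_) (push-⊛ δ (u ⊛ v) w eq) ⟩
    g ⊙ push δ ((u ⊛ v) ⊛ w)   ≡⟨ cong (λ x → g ⊙ push δ x) (⊛-assoc u v w eq) ⟩
    g ⊙ push δ (u ⊛ (v ⊛ w))   ∎
    where open ≡-Reasoning

  ⊛-identityʳ : ∀ u → reduced u ≡ true → u ⊛ ⌈ ε ⌉ ≡ u
  ⊛-identityʳ ⌈ g ⌉       eq = cong ⌈_⌉ (identityʳ g)
  ⊛-identityʳ (g ⟨ δ ⟩ w) eq = begin
    g ⊙ push δ (w ⊛ ⌈ ε ⌉)  ≡⟨ cong (λ x → g ⊙ push δ x) (⊛-identityʳ w (reduced-tail (g ⟨ δ ⟩ w) eq)) ⟩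
    g ⊙ push δ w            ≡⟨ cong (g ⊙_) (push-reduced g δ w eq) ⟩
    (g ∙ ε) ⟨ δ ⟩ w         ≡⟨ cong (_⟨ δ ⟩ w) (identityʳ g) ⟩
    g ⟨ δ ⟩ w               ∎
    where open ≡-Reasoning

  reduced-inv : ∀ u → reduced (inv u) ≡ true
  reduced-inv ⌈ g ⌉       = refl
  reduced-inv (g ⟨ δ ⟩ w) = reduced-⊛ (inv w) _ refl

  ⊛-inverseˡ : ∀ u → reduced u ≡ true → inv u ⊛ u ≡ ⌈ ε ⌉
  ⊛-inverseˡ ⌈ g ⌉       eq = cong ⌈_⌉ (inverseˡ g)
  ⊛-inverseˡ (g ⟨ δ ⟩ w) eq = begin
    (inv w ⊛ (ε ⟨ not δ ⟩ ⌈ g ⁻¹ ⌉)) ⊛ (g ⟨ δ ⟩ w)    ≡⟨ ⊛-assoc (inv w) _ _ eq ⟩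
    inv w ⊛ (ε ⊙ push (not δ) (((g ⁻¹) ∙ g) ⟨ δ ⟩ w))   ≡⟨ cong (inv w ⊛_) (⊙-identity _) ⟩
    inv w ⊛ push (not δ) (((g ⁻¹) ∙ g) ⟨ δ ⟩ w)         ≡⟨ cong (λ h → inv w ⊛ push (not δ) (h ⟨ δ ⟩ w)) (inverseˡ g) ⟩
    inv w ⊛ push (not δ) (ε ⟨ δ ⟩ w)                  ≡⟨ cong (inv w ⊛_) (push-cancelˡ δ w) ⟩
    inv w ⊛ w                                         ≡⟨ ⊛-inverseˡ w (reduced-tail (g ⟨ δ ⟩ w) eq) ⟩
    ⌈ ε ⌉                                             ∎
    where open ≡-Reasoning

  ⊛-inverseʳ : ∀ u → reduced u ≡ true → u ⊛ inv u ≡ ⌈ ε ⌉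
  ⊛-inverseʳ ⌈ g ⌉       eq = cong ⌈_⌉ (inverseʳ g)
  ⊛-inverseʳ (g ⟨ δ ⟩ w) eq = begin
    g ⊙ push δ (w ⊛ (inv w ⊛ γ⁻¹g⁻¹))          ≡⟨ cong (λ x → g ⊙ push δ x) (⊛-assoc w (inv w) γ⁻¹g⁻¹ refl) ⟨
    g ⊙ push δ ((w ⊛ inv w) ⊛ γ⁻¹g⁻¹)          ≡⟨ cong (λ x → g ⊙ push δ (x ⊛ γ⁻¹g⁻¹)) (⊛-inverseʳ w (reduced-tail (g ⟨ δ ⟩ w) eq)) ⟩
    g ⊙ push δ (ε ⊙ γ⁻¹g⁻¹)                    ≡⟨ cong (λ x → g ⊙ push δ x) (⊙-identity γ⁻¹g⁻¹) ⟩
    g ⊙ push δ γ⁻¹g⁻¹                   ≡⟨ cong (g ⊙_) (push-cancelʳ δ ⌈ g ⁻¹ ⌉) ⟩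
    ⌈ g ∙ (g ⁻¹) ⌉                      ≡⟨ cong ⌈_⌉ (inverseʳ g) ⟩
    ⌈ ε ⌉                                      ∎
    where
    open ≡-Reasoning
    γ⁻¹g⁻¹ = ε ⟨ not δ ⟩ ⌈ g ⁻¹ ⌉

  _≟ᵂ_ : DecidableEquality Word
  ⌈ g ⌉ ≟ᵂ ⌈ h ⌉ with g ≟ h
  ... | yes refl = yes refl
  ... | no g≢h   = no λ { refl → g≢h refl }
  ⌈ _ ⌉ ≟ᵂ (_ ⟨ _ ⟩ _) = no λ ()
  (_ ⟨ _ ⟩ _) ≟ᵂ ⌈ _ ⌉ = no λ ()
  (g ⟨ δ ⟩ v) ≟ᵂ (h ⟨ δ' ⟩ w) with g ≟ h | δ Bool.≟ δ' | v ≟ᵂ w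
  ... | yes refl | yes refl | yes refl = yes refl
  ... | no g≢h   | _        | _        = no λ { refl → g≢h refl }
  ... | yes _    | no δ≢δ'  | _        = no λ { refl → δ≢δ' refl }
  ... | yes _    | yes _    | no v≢w   = no λ { refl → v≢w refl }

  Reduced : Set
  Reduced = Σ[ w ∈ Word ] reduced w ≡ true

  -- Reducedness is a Boolean equation, so its proofs are unique.
  Reduced-≡ : {u v : Reduced} → proj₁ u ≡ proj₁ v → u ≡ v
  Reduced-≡ {w , p} {w , q} refl = cong (w ,_) (uip p q)

  _≟ᴿ_ : DecidableEquality Reduced
  (u , _) ≟ᴿ (v , _) with u ≟ᵂ v
  ... | yes u≡v = yes (Reduced-≡ u≡v)
  ... | no u≢v  = no λ u≡v → u≢v (cong proj₁ u≡v)

  _∙ᴿ_ : Reduced → Reduced → Reduced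
  (u , _) ∙ᴿ (v , v-red) = u ⊛ v , reduced-⊛ u v v-red

  _⁻¹ᴿ : Reduced → Reduced
  (u , _) ⁻¹ᴿ = inv u , reduced-inv u

  ι : G → Reduced
  ι g = ⌈ g ⌉ , refl

  γ : Reduced
  γ = ε ⟨ true ⟩ ⌈ ε ⌉ , refl

  isGroupᴿ : IsGroup _≡_ _∙ᴿ_ (ι ε) _⁻¹ᴿ
  isGroupᴿ = record
    { isMonoid = record
      { isSemigroup = record
        { isMagma = record { isEquivalence = isEquivalence ; ∙-cong = cong₂ _∙ᴿ_ }
        ; assoc = λ (u , _) (v , _) (w , w-red) → Reduced-≡ (⊛-assoc u v w w-red)
        }
      ; identity = (λ (u , _) → Reduced-≡ (⊙-identity u)) , λ (u , u-red) → Reduced-≡ (⊛-identityʳ u u-red)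
      }
    ; inverse = (λ (u , u-red) → Reduced-≡ (⊛-inverseˡ u u-red)) , λ (u , u-red) → Reduced-≡ (⊛-inverseʳ u u-red)
    ; ⁻¹-cong = cong _⁻¹ᴿ
    }

-- Groups labelled by filters of terms.

-- Φ g is the filter of the terms that the arrow u → u g is allowed to satisfy.
record LabelledGroup (e : Term) : Set₁ where
  infixl 7 _∙_
  infix  8 _⁻¹
  field
    Carrier : Set
    _∙_     : Carrier → Carrier → Carrier
    ε       : Carrier
    _⁻¹     : Carrier → Carrier
    isGroup : IsGroup _≡_ _∙_ ε _⁻¹
    _≟_     : DecidableEquality Carrier
    Φ       : Carrier → Term → Set
    Φ-up    : ∀ {g s t} → s ≤ t → Φ g s → Φ g t
    Φ-·     : ∀ {g s t} → Φ g s → Φ g t → Φ g (s · t)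
    Φ-∘     : ∀ {g h s t} → Φ g s → Φ h t → Φ (g ∙ h) (s ∘ t)
    Φ-ε⁺    : ∀ {t} → e ≤ t → Φ ε t
    Φ-ε⁻    : ∀ {t} → Φ ε t → e ≤ t

  open IsGroup isGroup public using (assoc; identityˡ; identityʳ; inverseˡ; inverseʳ)

  ∙-cancelˡ : ∀ g {h k} → g ∙ h ≡ g ∙ k → h ≡ k
  ∙-cancelˡ g = GroupProperties.∙-cancelˡ (record { isGroup = isGroup }) g _ _

  g[g⁻¹h]≡h : ∀ g h → g ∙ (g ⁻¹ ∙ h) ≡ h
  g[g⁻¹h]≡h g h = trans (sym (assoc g (g ⁻¹) h)) (trans (cong (_∙ h) (inverseʳ g)) (identityˡ h))

module _ (L : LabelledGroup e) where

  open LabelledGroup L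

  -- Possibly empty filters with a right action of `Φ`. The labels of the words `γ h`, as `h`
  -- varies, form such a family, and so do those of `γ⁻¹ h`.
  record IsModule (X : Carrier → Term → Set) : Set where
    field
      up   : ∀ {g s t} → s ≤ t → X g s → X g t
      meet : ∀ {g s t} → X g s → X g t → X g (s · t)
      act  : ∀ {g h s t} → X g s → Φ h t → X (g ∙ h) (s ∘ t)

  -- Ψ true h and Ψ false h are the prescribed labels of γ h and γ⁻¹ h.
  record GeneratorLabels : Set₁ where
    field
      Ψ        : Bool → Carrier → Term → Set
      isModule : ∀ δ → IsModule (Ψ δ)
      cancel   : ∀ δ {h s t} → Ψ δ ε s → Ψ (not δ) h t → Φ h (s ∘ t)

  Φ-isModule : IsModule Φ
  Φ-isModule = record { up = Φ-up ; meet = Φ-· ; act = Φ-∘ }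

-- Labels of reduced words.

module AdjoinGenerator (e≤𝟏 : e ≤ 𝟏) (L : LabelledGroup e) (Γ : GeneratorLabels L) where

  open LabelledGroup L
  open FreeExtension isGroup _≟_ public
  open GeneratorLabels Γ
  open IsModule

  -- The filter generated by compositions of labels along the word. `X` varies because a group
  -- element preceded by `γ` or `γ⁻¹` takes its labels from `Ψ`, not from `Φ`.
  Lab : (Carrier → Term → Set) → Word → Term → Set
  Lab X ⌈ g ⌉       t = X g t
  Lab X (g ⟨ δ ⟩ w) t = ∃[ p ] ∃[ q ] X g p × Lab (Ψ δ) w q × p ∘ q ≤ t

  private variable
    X Y : Carrier → Term → Set

  Lab-up : IsModule L X → ∀ w → s ≤ t → Lab X w s → Lab X w t
  Lab-up mod ⌈ g ⌉       s≤t x                       = up mod s≤t x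
  Lab-up mod (g ⟨ δ ⟩ w) s≤t (p , q , xp , yq , pq≤) = p , q , xp , yq , ≤-trans pq≤ s≤t

  Lab-· : IsModule L X → ∀ w → Lab X w s → Lab X w t → Lab X w (s · t)
  Lab-· mod ⌈ g ⌉       x                       x'                           = meet mod x x'
  Lab-· mod (g ⟨ δ ⟩ w) (p , q , xp , yq , pq≤) (p' , q' , xp' , yq' , pq≤') =
    p · p' , q · q' , meet mod xp xp' , Lab-· (isModule δ) w yq yq' ,
    ·-greatest (≤-trans (∘-mono ·-lowerˡ ·-lowerˡ) pq≤) (≤-trans (∘-mono ·-lowerʳ ·-lowerʳ) pq≤')

  ∘-regroup : p ∘ q ≤ t → (s ∘ p) ∘ q ≤ s ∘ t
  ∘-regroup {p} {q} {t} {s} pq≤t = ≤-trans (≤-reflexive (∘-assoc s p q)) (∘-monoʳ pq≤t)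

  Lab-⊙ : IsModule L X → ∀ g w → X g s → Lab Φ w t → Lab X (g ⊙ w) (s ∘ t)
  Lab-⊙ mod g ⌈ h ⌉       x φ                       = act mod x φ
  Lab-⊙ mod g (h ⟨ δ ⟩ w) x (p , q , φp , yq , pq≤) = _ , q , act mod x φp , yq , ∘-regroup pq≤

  Lab-shift : (∀ h {t} → X h t → Y h (s ∘ t)) → ∀ w → Lab X w t → Lab Y w (s ∘ t)
  Lab-shift f ⌈ h ⌉       x                       = f h x
  Lab-shift f (h ⟨ δ ⟩ w) (p , q , xp , yq , pq≤) = _ , q , f h xp , yq , ∘-regroup pq≤

  -- Without cancellation, `𝟏` labels the new leading `ε`. With cancellation the two prescribed
  -- labels meet, and `cancel` makes their composition a `Φ`-label of the first group element of the
  -- tail.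
  Lab-push : ∀ δ w → Lab (Ψ δ) w t → Lab Φ (push δ w) t
  Lab-push {t} δ w ψ with cancels δ w in c
  ... | false = 𝟏 , t , Φ-ε⁺ e≤𝟏 , ψ , ≤-reflexive (∘-identityˡ t)
  ... | true with subst (λ v → Lab (Ψ δ) v t) (cancels⇒ δ w c) ψ
  ...   | p , q , ψp , ψq , pq≤ =
    Lab-up (Φ-isModule L) (tail w) pq≤ (Lab-shift (λ h → cancel δ ψp) (tail w) ψq)

  -- Stated for every module, since behind a letter the induction continues in `Ψ δ`.
  Lab-⊛ : IsModule L X → ∀ u v → Lab X u s → Lab Φ v t → Lab X (u ⊛ v) (s ∘ t)
  Lab-⊛ mod ⌈ g ⌉       v x φ = Lab-⊙ mod g v x φ
  Lab-⊛ {t = t} mod (g ⟨ δ ⟩ w) v (p , q , xp , ψq , pq≤) φ =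
    Lab-up mod (g ⊙ push δ (w ⊛ v))
      (≤-trans (≤-reflexive (≈sym (∘-assoc p q t))) (∘-monoˡ pq≤))
      (Lab-⊙ mod g (push δ (w ⊛ v)) xp (Lab-push δ (w ⊛ v) (Lab-⊛ (isModule δ) w v ψq φ)))

  extension : LabelledGroup e
  extension = record
    { Carrier = Reduced
    ; _∙_     = _∙ᴿ_
    ; ε       = ι ε
    ; _⁻¹     = _⁻¹ᴿ
    ; isGroup = isGroupᴿ
    ; _≟_     = _≟ᴿ_
    ; Φ       = λ (w , _) → Lab Φ w
    ; Φ-up    = λ {(w , _)} → Lab-up (Φ-isModule L) w
    ; Φ-·     = λ {(w , _)} → Lab-· (Φ-isModule L) w
    ; Φ-∘     = λ {(u , _)} {(v , _)} → Lab-⊛ (Φ-isModule L) u v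
    -- By definition `⌈ g ⌉` has exactly the labels of `g`: the extension is conservative.
    ; Φ-ε⁺    = Φ-ε⁺
    ; Φ-ε⁻    = Φ-ε⁻
    }

-- Adjoining γ together with γ⁻¹ g splits an arrow g labelled b ∘ c as b followed by c.
module Splitting (e≤𝟏 : e ≤ 𝟏) (L : LabelledGroup e) where

  open LabelledGroup L

  -- The least module with label `a` at `k ⁻¹`: there `𝟏` labels `k ∙ k ⁻¹`, and the action carries
  -- `a` to `a ∘ q` at `h`.
  Shift : Term → Carrier → Carrier → Term → Set
  Shift a k h t = ∃[ q ] Φ (k ∙ h) q × a ∘ q ≤ t

  Shift-isModule : ∀ a k → IsModule L (Shift a k)
  Shift-isModule a k = record
    { up   = λ { s≤t (q , φ , aq≤) → q , φ , ≤-trans aq≤ s≤t }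
    ; meet = λ { (q , φ , aq≤) (q' , φ' , aq'≤) → q · q' , Φ-· φ φ' ,
               ·-greatest (≤-trans (∘-monoʳ ·-lowerˡ) aq≤) (≤-trans (∘-monoʳ ·-lowerʳ) aq'≤) }
    ; act  = λ { {g} {h} {t = t} (q , φ , aq≤) φt → q ∘ t ,
               subst (λ x → Φ x (q ∘ t)) (assoc k g h) (Φ-∘ φ φt) ,
               ≤-trans (≤-reflexive (≈sym (∘-assoc a q t))) (∘-monoˡ aq≤) }
    }

  module _ {b c : Term} (g : Carrier) (φ : Φ g (b ∘ c)) where

    Ψ : Bool → Carrier → Term → Set
    Ψ true  = Shift b ε
    Ψ false = Shift c (g ⁻¹)

    Ψ-isModule : ∀ δ → IsModule L (Ψ δ)
    Ψ-isModule true  = Shift-isModule b ε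
    Ψ-isModule false = Shift-isModule c (g ⁻¹)

    Ψ-cancel : ∀ δ {h s t} → Ψ δ ε s → Ψ (not δ) h t → Φ h (s ∘ t)
    Ψ-cancel true {h} {s} {t} (q , φq , bq≤s) (q' , φq' , cq'≤t) =
      subst (λ x → Φ x (s ∘ t)) (trans (identityˡ _) (g[g⁻¹h]≡h g h))
        (Φ-up bound (Φ-∘ (Φ-ε⁺ ≤-refl) (Φ-∘ φ φq')))
      where
      open ≤-Reasoning
      -- As `q` labels the unit, `s` lies above `b ∘ e`. The factor `e` is put in front of `b ∘ c`
      -- and reaches its place by centrality.
      e≤q : e ≤ q
      e≤q = Φ-ε⁻ (subst (λ x → Φ x q) (identityˡ ε) φq)
      bound : e ∘ ((b ∘ c) ∘ q') ≤ s ∘ t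
      bound = begin
        e ∘ ((b ∘ c) ∘ q')    ≈⟨ cong∘ ≈refl (∘-assoc b c q') ⟩
        e ∘ (b ∘ (c ∘ q'))    ≈⟨ ∘-assoc e b (c ∘ q') ⟨
        (e ∘ b) ∘ (c ∘ q')    ≈⟨ cong∘ (subidentity-central e≤𝟏 b) ≈refl ⟩
        (b ∘ e) ∘ (c ∘ q')    ≤⟨ ∘-mono (≤-trans (∘-monoʳ e≤q) bq≤s) cq'≤t ⟩
        s ∘ t                 ∎
    Ψ-cancel false {h} {s} {t} (q , φq , cq≤s) (q' , φq' , bq'≤t) =
      subst (λ x → Φ x (s ∘ t)) (trans (identityˡ _) (identityˡ h))
        (Φ-up bound (Φ-∘ (Φ-ε⁺ (rotate e≤𝟏 e≤bcq)) φq'))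
      where
      open ≤-Reasoning
      -- The letters meet in the opposite order: labels of `g` and `g ⁻¹ ∙ ε` compose to a term
      -- above `e` that starts with `b`, and `rotate` brings `b` to the end.
      e≤bcq : e ≤ b ∘ (c ∘ q)
      e≤bcq = ≤-trans (Φ-ε⁻ (subst (λ x → Φ x ((b ∘ c) ∘ q)) (g[g⁻¹h]≡h g ε) (Φ-∘ φ φq)))
                      (≤-reflexive (∘-assoc b c q))
      bound : ((c ∘ q) ∘ b) ∘ q' ≤ s ∘ t
      bound = begin
        ((c ∘ q) ∘ b) ∘ q'  ≈⟨ ∘-assoc (c ∘ q) b q' ⟩
        (c ∘ q) ∘ (b ∘ q')  ≤⟨ ∘-mono cq≤s bq'≤t ⟩
        s ∘ t               ∎

    labels : GeneratorLabels L
    labels = record { Ψ = Ψ ; isModule = Ψ-isModule ; cancel = Ψ-cancel }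

    open AdjoinGenerator e≤𝟏 L labels

    γ-label : LabelledGroup.Φ extension γ b
    γ-label = 𝟏 , b , Φ-ε⁺ e≤𝟏
            , (𝟏 , subst (λ x → Φ x 𝟏) (sym (identityˡ ε)) (Φ-ε⁺ e≤𝟏) , ≤-reflexive (∘-identityʳ b))
            , ≤-reflexive (∘-identityˡ b)

    γ⁻¹g : Reduced
    γ⁻¹g = ε ⟨ false ⟩ ⌈ g ⌉ , refl

    γ⁻¹g-label : LabelledGroup.Φ extension γ⁻¹g c
    γ⁻¹g-label = 𝟏 , c , Φ-ε⁺ e≤𝟏
               , (𝟏 , subst (λ x → Φ x 𝟏) (sym (inverseˡ g)) (Φ-ε⁺ e≤𝟏) , ≤-reflexive (∘-identityʳ c))
               , ≤-reflexive (∘-identityˡ c)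

    γ∙γ⁻¹g≡g : γ ∙ᴿ γ⁻¹g ≡ ι g
    γ∙γ⁻¹g≡g = Reduced-≡ (begin
      ε ⊙ push true (ε ⊙ (ε ⟨ false ⟩ ⌈ g ⌉))  ≡⟨ ⊙-identity _ ⟩
      push true (ε ⊙ (ε ⟨ false ⟩ ⌈ g ⌉))      ≡⟨ cong (push true) (⊙-identity (ε ⟨ false ⟩ ⌈ g ⌉)) ⟩
      push true (ε ⟨ false ⟩ ⌈ g ⌉)            ≡⟨ push-cancelʳ true ⌈ g ⌉ ⟩
      ⌈ g ⌉                                    ∎)
      where open ≡-Reasoning

-- Models and their integral algebras of relations.

-- `Φ` bounds what an arrow may satisfy; `steps` holds what has been put in so far.
record Model (e : Term) : Set₁ where
  field
    group : LabelledGroup e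
  open LabelledGroup group public
  field
    steps       : ℕ → List Carrier
    steps-label : ∀ {i h} → h ∈ steps i → Φ h (var i)

  ρ : ℕ → BRel Carrier
  ρ i u v = ∃[ h ] h ∈ steps i × v ≡ u ∙ h

⟦⟧-map : ∀ {U V : Set} {ρ : ℕ → BRel U} {ρ' : ℕ → BRel V} (f : U → V) →
         (∀ i {u v} → ρ i u v → ρ' i (f u) (f v)) →
         ∀ t {u v} → ⟦ t ⟧ ρ u v → ⟦ t ⟧ ρ' (f u) (f v)
⟦⟧-map f f-ρ (var i) r             = f-ρ i r
⟦⟧-map f f-ρ (s · t) (r , r')      = ⟦⟧-map f f-ρ s r , ⟦⟧-map f f-ρ t r'
⟦⟧-map f f-ρ (s ∘ t) (w , r , r')  = f w , ⟦⟧-map f f-ρ s r , ⟦⟧-map f f-ρ t r'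
⟦⟧-map f f-ρ 𝟏       refl          = refl

module _ (M : Model e) where

  open Model M

  -- Satisfaction never exceeds `Φ`, as labels are closed under meet and composition and `𝟏` labels
  -- the unit. In a meet, left cancellation identifies the two group elements.
  ⟦⟧-label : e ≤ 𝟏 → ∀ t {u v} → ⟦ t ⟧ ρ u v → ∃[ h ] Φ h t × v ≡ u ∙ h
  ⟦⟧-label e≤𝟏 (var i) (h , h∈ , v≡) = h , steps-label h∈ , v≡
  ⟦⟧-label e≤𝟏 (s · t) {u} (r , r') with ⟦⟧-label e≤𝟏 s r | ⟦⟧-label e≤𝟏 t r'
  ... | h , φ , v≡ | h' , φ' , v≡' =
    h , Φ-· φ (subst (λ k → Φ k t) (∙-cancelˡ u (trans (sym v≡') v≡)) φ') , v≡
  ⟦⟧-label e≤𝟏 (s ∘ t) {u} (w , r , r') with ⟦⟧-label e≤𝟏 s r | ⟦⟧-label e≤𝟏 t r'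
  ... | h , φ , refl | h' , φ' , v≡ = h ∙ h' , Φ-∘ φ φ' , trans v≡ (assoc u h h')
  ⟦⟧-label e≤𝟏 𝟏 {u} refl = ε , Φ-ε⁺ e≤𝟏 , sym (identityʳ u)

  ⟦⟧-translate : ∀ t k {u v} → ⟦ t ⟧ ρ u v → ⟦ t ⟧ ρ (k ∙ u) (k ∙ v)
  ⟦⟧-translate t k =
    ⟦⟧-map (k ∙_) (λ { i {u} (h , h∈ , refl) → h , h∈ , sym (assoc k u h) }) t

  ⟦⟧-∘ : ∀ s t {g h} → ⟦ s ⟧ ρ ε g → ⟦ t ⟧ ρ ε h → ⟦ s ∘ t ⟧ ρ ε (g ∙ h)
  ⟦⟧-∘ s t {g} {h} r r' =
    g , r , subst (λ k → ⟦ t ⟧ ρ k (g ∙ h)) (identityʳ g) (⟦⟧-translate t g r')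

  -- The list makes `ε ∈ hs` decidable, which gives `Id-minimal` without excluded middle: a relation
  -- inside `Id` is full or empty accordingly.
  FiniteInvariant : BRel Carrier → Set
  FiniteInvariant R =
    ∃[ hs ] (∀ {u v} → R u v → ∃[ h ] h ∈ hs × v ≡ u ∙ h) × (∀ {u h} → h ∈ hs → R u (u ∙ h))

  open DecMembership _≟_ using (_∈?_)

  finiteInvariant-integral : IsIntegralRelAlg Carrier (λ R → Lift _ (FiniteInvariant R))
  finiteInvariant-integral = record
    { respects = λ { (R⊆S , S⊆R) (lift (hs , to , from)) →
        lift (hs , (λ r → to (S⊆R _ _ r)) , λ h∈ → R⊆S _ _ (from h∈)) }
    ; closed∩ = λ { (lift R) (lift S) → lift (∩-closed R S) }
    ; closed⨾ = λ { (lift R) (lift S) → lift (⨾-closed R S) }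
    ; has∅ = lift ([] , (λ ()) , λ ())
    ; hasId = lift (ε ∷ [] , (λ { refl → ε , here refl , sym (identityʳ _) })
                           , λ { (here refl) → sym (identityʳ _) })
    ; Id≢∅ = λ { (Id⊆∅ , _) → Id⊆∅ ε ε refl }
    ; Id-minimal = λ { (lift R) → minimal R }
    }
    where
    ∩-closed : ∀ {R S} → FiniteInvariant R → FiniteInvariant S → FiniteInvariant (R ∩ S)
    ∩-closed {R} {S} (hs , to , from) (ks , to' , from') = filter (_∈? ks) hs , to∩ , from∩
      where
      to∩ : ∀ {u v} → (R ∩ S) u v → ∃[ h ] h ∈ filter (_∈? ks) hs × v ≡ u ∙ h
      to∩ {u} (r , r') with to r | to' r'
      ... | h , h∈ , v≡ | k , k∈ , v≡' =
        h , ∈-filter⁺ (_∈? ks) h∈ (subst (_∈ ks) (∙-cancelˡ u (trans (sym v≡') v≡)) k∈) , v≡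
      from∩ : ∀ {u h} → h ∈ filter (_∈? ks) hs → (R ∩ S) u (u ∙ h)
      from∩ h∈ with ∈-filter⁻ (_∈? ks) {xs = hs} h∈
      ... | h∈hs , h∈ks = from h∈hs , from' h∈ks

    ⨾-closed : ∀ {R S} → FiniteInvariant R → FiniteInvariant S → FiniteInvariant (R ⨾ S)
    ⨾-closed {R} {S} (hs , to , from) (ks , to' , from') = cartesianProductWith _∙_ hs ks , to⨾ , from⨾
      where
      to⨾ : ∀ {u v} → (R ⨾ S) u v → ∃[ h ] h ∈ cartesianProductWith _∙_ hs ks × v ≡ u ∙ h
      to⨾ {u} (w , r , r') with to r | to' r'
      ... | h , h∈ , refl | k , k∈ , v≡ =
        h ∙ k , ∈-cartesianProductWith⁺ _∙_ h∈ k∈ , trans v≡ (assoc u h k)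
      from⨾ : ∀ {u h} → h ∈ cartesianProductWith _∙_ hs ks → (R ⨾ S) u (u ∙ h)
      from⨾ {u} hk∈ with ∈-cartesianProductWith⁻ _∙_ hs ks hk∈
      ... | h , k , h∈ , k∈ , refl =
        u ∙ h , from h∈ , subst (S (u ∙ h)) (assoc u h k) (from' k∈)

    minimal : ∀ {R} → FiniteInvariant R → R ⊆ Id → ¬ (R ≐ ∅) → R ≐ Id
    minimal {R} (hs , to , from) R⊆Id R≢∅ with ε ∈? hs
    ... | yes ε∈ = R⊆Id , λ { u _ refl → subst (R u) (identityʳ u) (from ε∈) }
    ... | no ε∉  = contradiction (R⊆∅ , λ _ _ ()) R≢∅
      where
      R⊆∅ : R ⊆ ∅
      R⊆∅ u v r with to r
      ... | h , h∈ , v≡uh =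
        ε∉ (subst (_∈ hs) (∙-cancelˡ u (trans (sym v≡uh) (trans (sym (R⊆Id u v r)) (sym (identityʳ u))))) h∈)

  ρ-finiteInvariant : ∀ i → FiniteInvariant (ρ i)
  ρ-finiteInvariant i = steps i , (λ r → r) , λ h∈ → _ , h∈ , refl

-- Maps of models.

-- Labels are also reflected, so no later construction enlarges the filter of an earlier arrow;
-- steps are only preserved, since new ones may be added.
record _⟶_ (M N : Model e) : Set where
  private
    module M = Model M
    module N = Model N
  field
    f      : M.Carrier → N.Carrier
    homo-∙ : ∀ g h → f (g M.∙ h) ≡ f g N.∙ f h
    homo-ε : f M.ε ≡ N.ε
    Φ⁺     : ∀ {g t} → M.Φ g t → N.Φ (f g) t
    Φ⁻     : ∀ {g t} → N.Φ (f g) t → M.Φ g t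
    steps⁺ : ∀ {i h} → h ∈ M.steps i → f h ∈ N.steps i

  ⟦⟧⁺ : ∀ t {g} → ⟦ t ⟧ M.ρ M.ε g → ⟦ t ⟧ N.ρ N.ε (f g)
  ⟦⟧⁺ t {g} r = subst (λ u → ⟦ t ⟧ N.ρ u (f g)) homo-ε
    (⟦⟧-map f (λ { i {u} (h , h∈ , refl) → f h , steps⁺ h∈ , homo-∙ u h }) t r)

open _⟶_

⟶-id : {M : Model e} → M ⟶ M
⟶-id = record
  { f = λ g → g ; homo-∙ = λ _ _ → refl ; homo-ε = refl
  ; Φ⁺ = λ φ → φ ; Φ⁻ = λ φ → φ ; steps⁺ = λ h∈ → h∈ }

_⟫_ : {M N K : Model e} → M ⟶ N → N ⟶ K → M ⟶ K
F ⟫ F' = record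
  { f      = λ g → f F' (f F g)
  ; homo-∙ = λ g h → trans (cong (f F') (homo-∙ F g h)) (homo-∙ F' _ _)
  ; homo-ε = trans (cong (f F') (homo-ε F)) (homo-ε F')
  ; Φ⁺     = λ φ → Φ⁺ F' (Φ⁺ F φ)
  ; Φ⁻     = λ φ → Φ⁻ F (Φ⁻ F' φ)
  ; steps⁺ = λ h∈ → steps⁺ F' (steps⁺ F h∈)
  }

consIf : ∀ {P A : Set} → Dec P → A → List A → List A
consIf (yes _) x xs = x ∷ xs
consIf (no _)  _ xs = xs

module _ (M : Model e) where

  open Model M

  addStep : ∀ i g → Φ g (var i) → Model e
  addStep i g φ = record { group = group ; steps = steps' ; steps-label = label _ _ }
    where
    steps' : ℕ → List Carrier
    steps' j = consIf (i ℕ.≟ j) g (steps j)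
    label : ∀ j h → h ∈ steps' j → Φ h (var j)
    label j h h∈ with i ℕ.≟ j
    label j h (here refl) | yes refl = φ
    label j h (there h∈)  | yes refl = steps-label h∈
    label j h h∈          | no _     = steps-label h∈

  addStep-⟶ : ∀ i g (φ : Φ g (var i)) → M ⟶ addStep i g φ
  addStep-⟶ i g φ = record
    { f = λ h → h ; homo-∙ = λ _ _ → refl ; homo-ε = refl
    ; Φ⁺ = λ φ → φ ; Φ⁻ = λ φ → φ ; steps⁺ = λ {j} → weaken j }
    where
    weaken : ∀ j {h} → h ∈ steps j → h ∈ Model.steps (addStep i g φ) j
    weaken j h∈ with i ℕ.≟ j
    ... | yes refl = there h∈
    ... | no _     = h∈

  addStep-∈ : ∀ i g (φ : Φ g (var i)) → g ∈ Model.steps (addStep i g φ) i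
  addStep-∈ i g φ with i ℕ.≟ i
  ... | yes _  = here refl
  ... | no i≢i = contradiction refl i≢i

module AdjoinToModel (e≤𝟏 : e ≤ 𝟏) (M : Model e) (Γ : GeneratorLabels (Model.group M)) where

  open Model M
  open AdjoinGenerator e≤𝟏 group Γ

  adjoin : Model e
  adjoin = record { group = extension ; steps = λ i → map ι (steps i) ; steps-label = label }
    where
    label : ∀ {i h} → h ∈ map ι (steps i) → LabelledGroup.Φ extension h (var i)
    label h∈ with ∈-map⁻ ι h∈
    ... | _ , g∈ , refl = steps-label g∈

  adjoin-⟶ : M ⟶ adjoin
  adjoin-⟶ = record
    { f = ι ; homo-∙ = λ _ _ → refl ; homo-ε = refl
    ; Φ⁺ = λ φ → φ ; Φ⁻ = λ φ → φ ; steps⁺ = ∈-map⁺ ι }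

-- Realizing a labelled term by extending the model.

module _ {e : Term} (e≤𝟏 : e ≤ 𝟏) where

  open Model

  -- The last two fields keep the invariant that a test is required only at the unit, the one place
  -- where it can hold.
  record Split (M : Model e) (g : Carrier M) (b c : Term) : Set₁ where
    field
      {N}      : Model e
      into     : M ⟶ N
      k k'     : Carrier N
      k∙k'≡g   : _∙_ N k k' ≡ f into g
      k-label  : Φ N k b
      k'-label : Φ N k' c
      k-test   : test b ≡ true → k ≡ ε N
      k'-test  : test c ≡ true → k' ≡ ε N

  -- A test factor is put at the unit, where `test-Good` supplies its label, and the other factor
  -- keeps `g`. Only when neither is a test is a generator adjoined.
  split : ∀ M g b c → Good e (b ∘ c) → Φ M g (b ∘ c) → (test (b ∘ c) ≡ true → g ≡ ε M) → Split M g b c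
  split M g b c (b-good , c-good) φ g-test with test b in b-eq | test c in c-eq
  ... | true | c-test = record
    { into     = ⟶-id
    ; k∙k'≡g   = identityˡ M g
    ; k-label  = Φ-ε⁺ M (test-Good b e≤𝟏 b-good b-eq)
    ; k'-label = Φ-up M (∘-contractˡ (test⇒≤𝟏 b b-eq)) φ
    ; k-test   = λ _ → refl
    ; k'-test  = λ eq → g-test (trans (sym c-eq) eq)
    }
  ... | false | true = record
    { into     = ⟶-id
    ; k∙k'≡g   = identityʳ M g
    ; k-label  = Φ-up M (∘-contractʳ (test⇒≤𝟏 c c-eq)) φ
    ; k'-label = Φ-ε⁺ M (test-Good c e≤𝟏 c-good c-eq)
    ; k-test   = λ eq → contradiction eq (not-¬ b-eq)
    ; k'-test  = λ _ → refl
    }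
  ... | false | false = record
    { into     = adjoin-⟶
    ; k        = γ
    ; k'       = γ⁻¹g g φ
    ; k∙k'≡g   = γ∙γ⁻¹g≡g g φ
    ; k-label  = γ-label g φ
    ; k'-label = γ⁻¹g-label g φ
    ; k-test   = λ eq → contradiction eq (not-¬ b-eq)
    ; k'-test  = λ eq → contradiction eq (not-¬ c-eq)
    }
    where
    open Splitting e≤𝟏 (group M)
    open AdjoinGenerator e≤𝟏 (group M) (labels g φ) using (γ)
    open AdjoinToModel e≤𝟏 M (labels g φ)

  record Realization (M : Model e) (Goal : (N : Model e) → M ⟶ N → Set) : Set₁ where
    constructor realization
    field
      N    : Model e
      into : M ⟶ N
      goal : Goal N into

  Realizes : ∀ {M} → Term → Carrier M → (N : Model e) → M ⟶ N → Set
  Realizes t g N F = ⟦ t ⟧ (ρ N) (ε N) (f F g)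

  -- A variable adds the step `g`, a meet realizes both factors at `g`, a composition first splits
  -- `g`. The last hypothesis settles `𝟏`, and `Good` excludes `𝟎`.
  realize : ∀ t M g → Good e t → Φ M g t → (test t ≡ true → g ≡ ε M) → Realization M (Realizes t g)

  -- The factors are realized in turn; the first stays realized because maps of models preserve
  -- satisfaction.
  realize₂ : ∀ s t M g h → Good e s → Good e t → Φ M g s → Φ M h t →
             (test s ≡ true → g ≡ ε M) → (test t ≡ true → h ≡ ε M) →
             Realization M λ N F → Realizes s g N F × Realizes t h N F

  realize (var i) M g _ φ _ =
    realization (addStep M i g φ) (addStep-⟶ M i g φ) (g , addStep-∈ M i g φ , sym (identityˡ M g))
  realize (s · t) M g (s-good , t-good , _) φ g-test =
    realize₂ s t M g g s-good t-good (Φ-up M ·-lowerˡ φ) (Φ-up M ·-lowerʳ φ)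
      (λ eq → g-test (cong (_∨ test t) eq))
      (λ eq → g-test (trans (cong (test s ∨_) eq) (Bool.∨-zeroʳ (test s))))
  realize (s ∘ t) M g good@(s-good , t-good) φ g-test = realization N₂ (into ⟫ F₂) r
    where
    open Split (split M g s t good φ g-test)
    open Realization (realize₂ s t N k k' s-good t-good k-label k'-label k-test k'-test)
      renaming (N to N₂; into to F₂)
    r : Realizes (s ∘ t) g N₂ (into ⟫ F₂)
    r = subst (⟦ s ∘ t ⟧ (ρ N₂) (ε N₂)) (trans (sym (homo-∙ F₂ k k')) (cong (f F₂) k∙k'≡g))
          (⟦⟧-∘ N₂ s t (proj₁ goal) (proj₂ goal))
  realize 𝟏 M g _ _ g-test = realization M ⟶-id (sym (g-test refl))

  realize₂ s t M g h s-good t-good φ φ' g-test h-test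
    with realize s M g s-good φ g-test
  ... | realization N F r
    with realize t N (f F h) t-good (Φ⁺ F φ') (λ eq → trans (cong (f F) (h-test eq)) (homo-ε F))
  ... | realization N' F' r' = realization N' (F ⟫ F') (⟦⟧⁺ F' s r , r')

  trivial : Model e
  trivial = record
    { group = record
      { Carrier = ⊤
      ; _∙_     = λ _ _ → tt
      ; ε       = tt
      ; _⁻¹     = λ _ → tt
      ; isGroup = record
        { isMonoid = record
          { isSemigroup = record
            { isMagma = record { isEquivalence = isEquivalence ; ∙-cong = λ _ _ → refl }
            ; assoc = λ _ _ _ → refl }
          ; identity = (λ _ → refl) , λ _ → refl }
        ; inverse = (λ _ → refl) , λ _ → refl
        ; ⁻¹-cong = λ _ → refl }
      ; _≟_     = λ _ _ → yes refl
      ; Φ       = λ _ t → e ≤ t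
      ; Φ-up    = λ s≤t e≤s → ≤-trans e≤s s≤t
      ; Φ-·     = ·-greatest
      ; Φ-∘     = λ e≤s e≤t → ≤-trans (≤-reflexive (≈sym (subidentity-idem e≤𝟏))) (∘-mono e≤s e≤t)
      ; Φ-ε⁺    = λ e≤t → e≤t
      ; Φ-ε⁻    = λ e≤t → e≤t
      }
    ; steps = λ _ → []
    ; steps-label = λ ()
    }

  -- `g-least` makes the filter of `g` principal, so that each of its labels is a provable upper
  -- bound of `s`.
  record Start (s : Term) : Set₁ where
    field
      M       : Model e
      g       : Carrier M
      g-label : Φ M g s
      g-test  : test s ≡ true → g ≡ ε M
      g-least : ∀ {t} → Φ M g t → s ≤ t

  module _ {s : Term} (s≤s∘e : s ≤ s ∘ e) where

    -- The inverse of an arrow labelled s carries no label at all.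
    arrowLabels : GeneratorLabels (group trivial)
    arrowLabels = record
      { Ψ        = Ψ
      ; isModule = λ { true  → record { up = λ s≤t r → ≤-trans r s≤t ; meet = ·-greatest
                                      ; act = λ s≤a e≤b → ≤-trans s≤s∘e (∘-mono s≤a e≤b) }
                     ; false → record { up = λ _ () ; meet = λ () ; act = λ () } }
      ; cancel   = λ { true _ () ; false () _ }
      }
      where
      Ψ : Bool → ⊤ → Term → Set
      Ψ true  _ t = s ≤ t
      Ψ false _ _ = ⊥

    start : Good e s → Start s
    start good with test s in eq
    ... | true = record
      { M       = trivial
      ; g       = tt
      ; g-label = test-Good s e≤𝟏 good eq
      ; g-test  = λ _ → refl
      -- A test `s` satisfies `s ≤ s ∘ e ≤ e`.
      ; g-least = λ e≤t → ≤-trans s≤s∘e (≤-trans (∘-contractˡ (test⇒≤𝟏 s eq)) e≤t)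
      }
    ... | false = record
      { M       = adjoin
      ; g       = γ
      ; g-label = 𝟏 , s , e≤𝟏 , ≤-refl , ≤-reflexive (∘-identityˡ s)
      ; g-test  = λ eq' → contradiction eq' (not-¬ eq)
      -- A label of `γ` lies above some `p ∘ q` with `e ≤ p` and `s ≤ q`, hence above `e ∘ s`, which
      -- is `s ∘ e`.
      ; g-least = λ { (p , q , e≤p , s≤q , pq≤t) → ≤-trans s≤s∘e (≤-trans
                      (≤-reflexive (≈sym (subidentity-central e≤𝟏 s))) (≤-trans (∘-mono e≤p s≤q) pq≤t)) }
      }
      where
      open AdjoinGenerator e≤𝟏 (group trivial) arrowLabels using (γ)
      open AdjoinToModel e≤𝟏 trivial arrowLabels using (adjoin)

-- Completeness: valid inequalities are derivable.

-- In the final model the arrow satisfies `s`, so `t` by validity, so `t` labels it. Reflected to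
-- the starting arrow, this label lies above `s`.
valid⇒≤ : ∀ s t → ValidRelI s t → s ≤ t
valid⇒≤ s t valid with zero-or-testPart s
... | inj₁ s≤𝟎 = ≤-trans s≤𝟎 𝟎-least
... | inj₂ (testPart e e≤𝟏 s≤s∘e good) = g-least (Φ⁻ into label)
  where
  open Start (start e≤𝟏 s≤s∘e good)
  open Realization (realize e≤𝟏 s M g good g-label g-test)
  open Model N using (Carrier; Φ; ρ; ε; identityˡ)

  ⟦t⟧ : ⟦ t ⟧ ρ ε (f into g)
  ⟦t⟧ = proj₁ (valid Carrier _ (finiteInvariant-integral N) ρ (λ i → lift (ρ-finiteInvariant N i))) _ _ goal

  label : Φ (f into g) t
  label with ⟦⟧-label N e≤𝟏 t ⟦t⟧
  ... | h , φ , g≡ = subst (λ k → Φ k t) (sym (trans g≡ (identityˡ h))) φ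

completeness : ∀ s t → ValidRelI s t → Ax⊢ s ≈ t
completeness s t valid = ≤-antisym (valid⇒≤ s t valid) (valid⇒≤ t s λ U A alg ρ ρ∈A → swap (valid U A alg ρ ρ∈A))

-- Soundness of the axioms in integral relation algebras.

⟦⟧-subst : ∀ {U : Set} (σ : ℕ → Term) (ρ : ℕ → BRel U) t → ⟦ t [ σ ] ⟧ ρ ≡ ⟦ t ⟧ (λ i → ⟦ σ i ⟧ ρ)
⟦⟧-subst σ ρ (var i) = refl
⟦⟧-subst σ ρ (s · t) = cong₂ _∩_ (⟦⟧-subst σ ρ s) (⟦⟧-subst σ ρ t)
⟦⟧-subst σ ρ (s ∘ t) = cong₂ _⨾_ (⟦⟧-subst σ ρ s) (⟦⟧-subst σ ρ t)
⟦⟧-subst σ ρ 𝟎       = refl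
⟦⟧-subst σ ρ 𝟏       = refl

module _ {U : Set} {A : BRel U → Set₁} (alg : IsIntegralRelAlg U A) where

  open IsIntegralRelAlg alg

  ⟦⟧-closed : ∀ {ρ} → (∀ i → A (ρ i)) → ∀ t → A (⟦ t ⟧ ρ)
  ⟦⟧-closed ρ∈A (var i) = ρ∈A i
  ⟦⟧-closed ρ∈A (s · t) = closed∩ (⟦⟧-closed ρ∈A s) (⟦⟧-closed ρ∈A t)
  ⟦⟧-closed ρ∈A (s ∘ t) = closed⨾ (⟦⟧-closed ρ∈A s) (⟦⟧-closed ρ∈A t)
  ⟦⟧-closed ρ∈A 𝟎       = has∅
  ⟦⟧-closed ρ∈A 𝟏       = hasId

  -- Here integrality enters: a loop makes `Id ∩ R` nonempty, so it is all of `Id`.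
  loop-everywhere : ∀ {R} → A R → ∀ {u} v → R u u → R v v
  loop-everywhere {R} R∈A {u} v r = proj₂ (Id⊆ v v refl)
    where
    Id⊆ : Id ⊆ (Id ∩ R)
    Id⊆ = proj₂ (Id-minimal (closed∩ hasId R∈A) (λ _ _ → proj₁) λ (⊆∅ , _) → ⊆∅ u u (refl , r))

  axiom-sound : ∀ {l r ρ} → (∀ i → A (ρ i)) → AxI l r → ⟦ l ⟧ ρ ≐ ⟦ r ⟧ ρ
  axiom-sound ρ∈A idem   = (λ _ _ → proj₁) , λ _ _ r → r , r
  axiom-sound ρ∈A comm   = (λ _ _ → swap) , λ _ _ → swap
  axiom-sound ρ∈A assoc· = (λ { _ _ ((p , q) , r) → p , q , r }) , λ { _ _ (p , q , r) → (p , q) , r }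
  axiom-sound ρ∈A assoc∘ = (λ { _ _ (w , (w' , p , q) , r) → w' , p , w , q , r })
                         , λ { _ _ (w' , p , w , q , r) → w , (w' , p , q) , r }
  axiom-sound ρ∈A unitl  = (λ { _ _ (_ , refl , r) → r }) , λ _ _ r → _ , refl , r
  axiom-sound ρ∈A unitr  = (λ { _ _ (_ , r , refl) → r }) , λ _ _ r → _ , r , refl
  axiom-sound ρ∈A mono   = (λ _ _ → proj₁) , λ { _ _ m@(w , (p , _) , (q , _)) → m , w , p , q }
  axiom-sound ρ∈A zero·  = (λ _ _ ()) , λ { _ _ (() , _) }
  axiom-sound ρ∈A zero∘l = (λ _ _ ()) , λ { _ _ (_ , () , _) }
  axiom-sound ρ∈A zero∘r = (λ _ _ ()) , λ { _ _ (_ , _ , ()) }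
  axiom-sound ρ∈A ax1    = (λ { _ _ (_ , (refl , p) , (refl , q)) → (refl , p) , q })
                         , λ { _ _ ((refl , p) , q) → _ , (refl , p) , (refl , q) }
  axiom-sound ρ∈A ax2    = (λ { _ _ (w , (refl , p) , (q , r)) → (w , (refl , p) , q) , r })
                         , λ { _ _ ((w , (refl , p) , q) , r) → w , (refl , p) , (q , r) }
  axiom-sound ρ∈A ax3    = (λ { _ _ (w , (p , q) , (refl , r)) → p , w , q , (refl , r) })
                         , λ { _ _ (p , w , q , (refl , r)) → w , (p , q) , (refl , r) }
  axiom-sound ρ∈A int1   = cyclic (ρ∈A 1) (ρ∈A 0) , cyclic (ρ∈A 0) (ρ∈A 1)
    where
    cyclic : ∀ {R S} → A R → A S → (Id ∩ (S ⨾ R)) ⊆ (Id ∩ (R ⨾ S))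
    -- A loop at `u` through `w` is a loop of the reversed composition at `w`; integrality carries
    -- it back to `u`.
    cyclic R∈A S∈A u _ (refl , w , s , r) = refl , loop-everywhere (closed⨾ R∈A S∈A) u (u , r , s)
  axiom-sound ρ∈A int2   = (λ { _ v (w , (refl , p) , q) → v , q , (refl , loop-everywhere (ρ∈A 0) v p) })
                         , λ { u _ (w , q , (refl , p)) → u , (refl , loop-everywhere (ρ∈A 0) u p) , q }

  soundness : ∀ {s t} → Ax⊢ s ≈ t → ∀ {ρ} → (∀ i → A (ρ i)) → ⟦ s ⟧ ρ ≐ ⟦ t ⟧ ρ
  soundness (ax l≈r)     ρ∈A = axiom-sound ρ∈A l≈r
  soundness ≈refl        ρ∈A = (λ _ _ r → r) , λ _ _ r → r
  soundness (≈sym p)     ρ∈A = swap (soundness p ρ∈A)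
  soundness (≈trans p q) ρ∈A with soundness p ρ∈A | soundness q ρ∈A
  ... | s⊆t , t⊆s | t⊆u , u⊆t = (λ x y r → t⊆u x y (s⊆t x y r)) , λ x y r → t⊆s x y (u⊆t x y r)
  soundness (≈subst {s} {t} σ p) {ρ} ρ∈A
    rewrite ⟦⟧-subst σ ρ s | ⟦⟧-subst σ ρ t = soundness p (λ i → ⟦⟧-closed ρ∈A (σ i))
  soundness (cong· p q) ρ∈A with soundness p ρ∈A | soundness q ρ∈A
  ... | s⊆ , ⊆s | t⊆ , ⊆t =
    (λ { x y (r , r') → s⊆ x y r , t⊆ x y r' }) , λ { x y (r , r') → ⊆s x y r , ⊆t x y r' }
  soundness (cong∘ p q) ρ∈A with soundness p ρ∈A | soundness q ρ∈A
  ... | s⊆ , ⊆s | t⊆ , ⊆t =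
    (λ { x y (w , r , r') → w , s⊆ x w r , t⊆ w y r' }) , λ { x y (w , r , r') → w , ⊆s x w r , ⊆t w y r' }

theorem2p1 : (s t : Term) → (ValidRelI s t → Ax⊢ s ≈ t) × (Ax⊢ s ≈ t → ValidRelI s t)
theorem2p1 s t = completeness s t , λ s≈t U A alg ρ ρ∈A → soundness alg s≈t ρ∈A
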